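{- Let $\mathcal{R}$ be a finite valuation ring of order $q^r$, let $\mathcal{E}$ be a set of points in $\mathcal{R}^2$ and $\mathcal{L}$ a set of lines in $\mathcal{R}^2$. Then the number $I(\mathcal{E},\mathcal{L})$ of incidences between $\mathcal{E}$ and $\mathcal{L}$ (pairs $(P,\ell)\in\mathcal{E}\times\mathcal{L}$ with $P\in\ell$) satisfies \[\left|I(\mathcal{E},\mathcal{L})-\frac{|\mathcal{E}||\mathcal{L}|}{q^r}\right|\le q^{(2r-1)/2}\sqrt{|\mathcal{E}||\mathcal{L}|}.\]
   Context: $\mathcal{R}$ is a finite valuation ring: a finite commutative local ring with identity whose ideals are totally ordered by inclusion (a finite chain ring); its residue field has $q$ elements, $q$ an odd prime power, and $|\mathcal{R}|=q^r$; $\mathcal{R}^0$ denotes its set of non-units. A line in $\mathcal{R}^2$ is a set $\{(x,y)\in\mathcal{R}^2\colon ax+by+c=0\}$ with $(a,b,c)\in\mathcal{R}^3\setminus(\mathcal{R}^0)^3$. -}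

module Defs where

open import Level using (0ℓ)
open import Data.Nat using (ℕ; _*_; _^_; _≤_; _∸_; ∣_-_∣) renaming (_+_ to _+ℕ_)
open import Data.Nat.Primality using (Prime)
open import Data.Nat.Divisibility using (_∣_)
open import Data.Product using (Σ; ∃; ∃-syntax; _×_; _,_; proj₁; proj₂)
open import Data.Sum using (_⊎_)
open import Data.List using (List; length; filter; cartesianProduct)
open import Data.List.Membership.Propositional using (_∈_)
open import Data.List.Relation.Unary.Unique.Propositional using (Unique)
open import Data.List.Relation.Unary.AllPairs using (AllPairs)
open import Relation.Binary.PropositionalEquality using (_≡_)
open import Relation.Nullary using (¬_; Dec)
open import Relation.Binary.Definitions using (DecidableEquality)
open import Algebra.Structures using (IsCommutativeRing)

record FiniteCommRing : Set₁ where
  field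
    Carrier : Set
    _+_ : Carrier → Carrier → Carrier
    _·_ : Carrier → Carrier → Carrier
    -_  : Carrier → Carrier
    𝟘 𝟙 : Carrier
    isCommutativeRing : IsCommutativeRing _≡_ _+_ _·_ -_ 𝟘 𝟙
    _≟_ : DecidableEquality Carrier
    elements : List Carrier
    complete : ∀ x → x ∈ elements
    unique   : Unique elements

  infixl 6 _+_
  infixl 7 _·_

  card : ℕ
  card = length elements

  IsUnit : Carrier → Set
  IsUnit a = ∃[ u ] (a · u ≡ 𝟙)

  NonUnit : Carrier → Set
  NonUnit a = ¬ IsUnit a

  record Ideal : Set₁ where
    field
      mem     : Carrier → Set
      has-𝟘   : mem 𝟘
      +-closed : ∀ {a b} → mem a → mem b → mem (a + b)
      ·-closed : ∀ r {a} → mem a → mem (r · a)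

  open Ideal public

  _⊆ᴵ_ : Ideal → Ideal → Set
  I ⊆ᴵ J = ∀ x → mem I x → mem J x

  -- local: 1 ≠ 0 and the non-units form an ideal (closed under +; closure
  -- under multiplication and containing 0 is automatic)
  IsLocal : Set
  IsLocal = (¬ 𝟙 ≡ 𝟘) × (∀ a b → NonUnit a → NonUnit b → NonUnit (a + b))

  IsChain : Set₁
  IsChain = ∀ (I J : Ideal) → (I ⊆ᴵ J) ⊎ (J ⊆ᴵ I)

  -- congruence modulo the maximal ideal R⁰
  _∼_ : Carrier → Carrier → Set
  a ∼ b = NonUnit (a + (- b))

  ResidueFieldCard : ℕ → Set
  ResidueFieldCard q = Σ (List Carrier) λ reps →
    (length reps ≡ q) × AllPairs (λ a b → ¬ a ∼ b) reps × (∀ x → ∃[ y ] (y ∈ reps × x ∼ y))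

  Point : Set
  Point = Carrier × Carrier

  record Line : Set where
    constructor line
    pattern
    field
      a b c : Carrier
      nondeg : ¬ (NonUnit a × NonUnit b × NonUnit c)

  _on_ : Point → Line → Set
  (x , y) on line a b c _ = a · x + b · y + c ≡ 𝟘

  _on?_ : ∀ P ℓ → Dec (P on ℓ)
  (x , y) on? line a b c _ = (a · x + b · y + c) ≟ 𝟘

  SameLine : Line → Line → Set
  SameLine ℓ ℓ′ = ∀ P → (P on ℓ → P on ℓ′) × (P on ℓ′ → P on ℓ)

  IsLineSet : List Line → Set
  IsLineSet = AllPairs (λ ℓ ℓ′ → ¬ SameLine ℓ ℓ′)

  incidences : List Point → List Line → ℕ
  incidences E L = length (filter (λ Pℓ → proj₁ Pℓ on? proj₂ Pℓ) (cartesianProduct E L))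

OddPrimePower : ℕ → Set
OddPrimePower q = ∃[ p ] ∃[ k ] (Prime p × ¬ (2 ∣ p) × 1 ≤ k × q ≡ p ^ k)

{-# OPTIONS --safe #-}
-- Let N = |R| and let M be the number of non-units, so q M ≤ N.  Every line is one of the N² sets
-- s x + y + t = 0, the N M sets s y + x + t = 0 with s a non-unit, or the empty set.  Each point
-- is on N + M of them, each of them has at most N points, and, R being a chain ring, any two
-- points lie on a common line; hence for fixed P the excess λ(P, P′) − 1 of the number of common
-- lines is non-negative and sums to at most N M over all P′.  Expanding the square gives
-- Σ_ℓ (N |E ∩ ℓ| − |E|)² ≤ |E| N³ M over all lines, where the single extra term |E|² of the empty
-- line is absorbed by −|E|² N M, and Cauchy–Schwarz over L finishes the proof.
module Submission where

open import Algebra.Bundles using (CommutativeRing)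
import Algebra.Properties.Ring as RingProperties
open import Data.Empty using (⊥)
open import Data.List.Base using (List; []; _∷_; _++_; map; length; filter; cartesianProduct; cartesianProductWith)
open import Data.List.Membership.Propositional using (_∈_; find; lose)
open import Data.List.Membership.Propositional.Properties
open import Data.List.Properties using (length-++; length-map)
open import Data.List.Relation.Binary.Disjoint.Propositional using (Disjoint)
open import Data.List.Relation.Binary.Subset.Propositional using (_⊆_)
open import Data.List.Relation.Unary.All as All using (All)
open import Data.List.Relation.Unary.AllPairs as AllPairs using (AllPairs; []; _∷_)
import Data.List.Relation.Unary.AllPairs.Properties as AllPairs
open import Data.List.Relation.Unary.Any using (here; there; any?)
open import Data.List.Relation.Unary.Unique.Propositional using (Unique)
import Data.List.Relation.Unary.Unique.Propositional.Properties as Unique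
open import Data.Nat.Base as ℕ using (ℕ; suc)
open import Data.Nat.Primality using (prime⇒nonZero)
import Data.Nat.Properties as ℕ
open import Data.Product.Base using (∃; _×_; _,_; proj₁; proj₂)
open import Data.Sum.Base using (_⊎_; inj₁; inj₂)
open import Defs
open import Function.Base using (_∘_)
open import Function.Bundles using (_⇔_; mk⇔; Equivalence)
open import Relation.Binary.PropositionalEquality
open import Relation.Nullary using (¬_; Dec; yes; no; contradiction)
open import Relation.Nullary.Decidable using (map′; ¬?)
open import Relation.Unary using (Pred; Decidable)

-- Finite sums of integers over lists.

module IntegerSums where

  open import Data.Integer.Base using (ℤ; +_; -[1+_]; 0ℤ; 1ℤ; _+_; _*_; _-_; -_; _⊖_; ∣_∣; _≤_; +≤+; nonNegative)
  open import Data.Integer.Properties hiding (_≟_)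
  open import Data.Integer.Tactic.RingSolver using (solve-∀)

  private variable
    A B C : Set

  sum : List A → (A → ℤ) → ℤ
  sum []       f = 0ℤ
  sum (x ∷ xs) f = f x + sum xs f

  syntax sum xs (λ x → e) = ∑[ x ∈ xs ] e
  infix 5 sum

  sum-cong : (xs : List A) {f g : A → ℤ} → (∀ x → f x ≡ g x) → sum xs f ≡ sum xs g
  sum-cong []       eq = refl
  sum-cong (x ∷ xs) eq = cong₂ _+_ (eq x) (sum-cong xs eq)

  sum-mono : (xs : List A) {f g : A → ℤ} → (∀ x → f x ≤ g x) → sum xs f ≤ sum xs g
  sum-mono []       le = ≤-refl
  sum-mono (x ∷ xs) le = +-mono-≤ (le x) (sum-mono xs le)

  sum-const : (xs : List A) (c : ℤ) → ∑[ x ∈ xs ] c ≡ + length xs * c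
  sum-const []       c = sym (*-zeroˡ c)
  sum-const (x ∷ xs) c = begin
    c + sum xs (λ _ → c)        ≡⟨ cong (_+_ c) (sum-const xs c) ⟩
    c + + length xs * c         ≡⟨ lemma c (+ length xs) ⟩
    (1ℤ + + length xs) * c      ∎
    where
    open ≡-Reasoning
    lemma : ∀ c l → c + l * c ≡ (1ℤ + l) * c
    lemma = solve-∀

  sum-0 : (xs : List A) → ∑[ x ∈ xs ] 0ℤ ≡ 0ℤ
  sum-0 xs = trans (sum-const xs 0ℤ) (*-zeroʳ (+ length xs))

  sum-1 : (xs : List A) → ∑[ x ∈ xs ] 1ℤ ≡ + length xs
  sum-1 xs = trans (sum-const xs 1ℤ) (*-identityʳ (+ length xs))

  sum-+ : (xs : List A) (f g : A → ℤ) → ∑[ x ∈ xs ] (f x + g x) ≡ sum xs f + sum xs g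
  sum-+ []       f g = refl
  sum-+ (x ∷ xs) f g = trans (cong (_+_ (f x + g x)) (sum-+ xs f g))
    (lemma (f x) (g x) (sum xs f) (sum xs g))
    where
    lemma : ∀ a b c d → a + b + (c + d) ≡ a + c + (b + d)
    lemma = solve-∀

  sum-*ˡ : (xs : List A) (c : ℤ) (f : A → ℤ) → ∑[ x ∈ xs ] (c * f x) ≡ c * sum xs f
  sum-*ˡ []       c f = sym (*-zeroʳ c)
  sum-*ˡ (x ∷ xs) c f = trans (cong (_+_ (c * f x)) (sum-*ˡ xs c f))
    (sym (*-distribˡ-+ c (f x) (sum xs f)))

  sum-*ʳ : (xs : List A) (c : ℤ) (f : A → ℤ) → ∑[ x ∈ xs ] (f x * c) ≡ sum xs f * c
  sum-*ʳ xs c f = trans (sum-cong xs (λ x → *-comm (f x) c))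
    (trans (sum-*ˡ xs c f) (*-comm c (sum xs f)))

  sum-minus : (xs : List A) (f : A → ℤ) (c : ℤ) →
    ∑[ x ∈ xs ] (f x - c) ≡ sum xs f - + length xs * c
  sum-minus xs f c = trans (sum-+ xs f (λ _ → - c))
    (cong (λ z → sum xs f + z) (trans (sum-const xs (- c)) (sym (neg-distribʳ-* (+ length xs) c))))

  sum-swap : (xs : List A) (ys : List B) (f : A → B → ℤ) →
    ∑[ x ∈ xs ] ∑[ y ∈ ys ] f x y ≡ ∑[ y ∈ ys ] ∑[ x ∈ xs ] f x y
  sum-swap []       ys f = sym (sum-0 ys)
  sum-swap (x ∷ xs) ys f = trans (cong (_+_ (sum ys (f x))) (sum-swap xs ys f))
    (sym (sum-+ ys (f x) (λ y → ∑[ x ∈ xs ] f x y)))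

  sum-++ : (xs ys : List A) (f : A → ℤ) → sum (xs ++ ys) f ≡ sum xs f + sum ys f
  sum-++ []       ys f = sym (+-identityˡ (sum ys f))
  sum-++ (x ∷ xs) ys f = trans (cong (_+_ (f x)) (sum-++ xs ys f))
    (sym (+-assoc (f x) (sum xs f) (sum ys f)))

  sum-map : (g : A → B) (xs : List A) (f : B → ℤ) → sum (map g xs) f ≡ ∑[ x ∈ xs ] f (g x)
  sum-map g []       f = refl
  sum-map g (x ∷ xs) f = cong (_+_ (f (g x))) (sum-map g xs f)

  sum-cartesianProductWith : (g : A → B → C) (xs : List A) (ys : List B) (f : C → ℤ) →
    sum (cartesianProductWith g xs ys) f ≡ ∑[ x ∈ xs ] ∑[ y ∈ ys ] f (g x y)
  sum-cartesianProductWith g []       ys f = refl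
  sum-cartesianProductWith g (x ∷ xs) ys f =
    trans (sum-++ (map (g x) ys) (cartesianProductWith g xs ys) f)
      (cong₂ _+_ (sum-map (g x) ys f) (sum-cartesianProductWith g xs ys f))

  length-cartesianProductWith : (g : A → B → C) (xs : List A) (ys : List B) →
    length (cartesianProductWith g xs ys) ≡ length xs ℕ.* length ys
  length-cartesianProductWith g []       ys = refl
  length-cartesianProductWith g (x ∷ xs) ys = trans (length-++ (map (g x) ys))
    (cong₂ ℕ._+_ (length-map (g x) ys) (length-cartesianProductWith g xs ys))

  sum-square : (xs : List A) (f : A → ℤ) →
    sum xs f * sum xs f ≡ ∑[ x ∈ xs ] ∑[ y ∈ xs ] (f x * f y)
  sum-square xs f = sym (trans (sum-cong xs (λ x → sum-*ˡ xs (f x) f)) (sum-*ʳ xs (sum xs f) f))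

  -- Serves twice: with `c` the head of a list in Cauchy-Schwarz, and with `c` the size of the point
  -- set in the second moment.
  sum-[f-c]² : (xs : List A) (f : A → ℤ) (c : ℤ) →
    ∑[ x ∈ xs ] ((f x - c) * (f x - c)) ≡
    (∑[ x ∈ xs ] (f x * f x)) - + 2 * c * sum xs f + + length xs * (c * c)
  sum-[f-c]² []       f c = lemma c
    where
    lemma : ∀ c → 0ℤ ≡ 0ℤ - + 2 * c * 0ℤ + 0ℤ * (c * c)
    lemma = solve-∀
  sum-[f-c]² (x ∷ xs) f c = trans (cong (_+_ ((f x - c) * (f x - c))) (sum-[f-c]² xs f c))
    (lemma (f x) c (∑[ x ∈ xs ] (f x * f x)) (sum xs f) (+ length xs))
    where
    lemma : ∀ a c q s l → (a - c) * (a - c) + (q - + 2 * c * s + l * (c * c)) ≡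
      a * a + q - + 2 * c * (a + s) + (1ℤ + l) * (c * c)
    lemma = solve-∀

  i*i≡∣i∣*∣i∣ : ∀ i → i * i ≡ + (∣ i ∣ ℕ.* ∣ i ∣)
  i*i≡∣i∣*∣i∣ (+ n)    = sym (pos-* n n)
  i*i≡∣i∣*∣i∣ -[1+ n ] = refl

  i*i≥0 : ∀ i → 0ℤ ≤ i * i
  i*i≥0 i = subst (0ℤ ≤_) (sym (i*i≡∣i∣*∣i∣ i)) (+≤+ ℕ.z≤n)

  ∣m⊖n∣≡∣m-n∣ : ∀ m n → ∣ m ⊖ n ∣ ≡ ℕ.∣ m - n ∣
  ∣m⊖n∣≡∣m-n∣ ℕ.zero  ℕ.zero  = refl
  ∣m⊖n∣≡∣m-n∣ ℕ.zero  (suc n) = refl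
  ∣m⊖n∣≡∣m-n∣ (suc m) ℕ.zero  = refl
  ∣m⊖n∣≡∣m-n∣ (suc m) (suc n) = trans (cong ∣_∣ ([1+m]⊖[1+n]≡m⊖n m n)) (∣m⊖n∣≡∣m-n∣ m n)

  [m-n]²≡∣m-n∣² : ∀ m n → (+ m - + n) * (+ m - + n) ≡ + (ℕ.∣ m - n ∣ ℕ.^ 2)
  [m-n]²≡∣m-n∣² m n = begin
    (+ m - + n) * (+ m - + n)                ≡⟨ cong (λ z → z * z) ([+m]-[+n]≡m⊖n m n) ⟩
    (m ⊖ n) * (m ⊖ n)                        ≡⟨ i*i≡∣i∣*∣i∣ (m ⊖ n) ⟩
    + (∣ m ⊖ n ∣ ℕ.* ∣ m ⊖ n ∣)              ≡⟨ cong (λ d → + (d ℕ.* d)) (∣m⊖n∣≡∣m-n∣ m n) ⟩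
    + (ℕ.∣ m - n ∣ ℕ.* ℕ.∣ m - n ∣)          ≡⟨ cong (λ d → + (ℕ.∣ m - n ∣ ℕ.* d)) (ℕ.*-identityʳ _) ⟨
    + (ℕ.∣ m - n ∣ ℕ.^ 2)                    ∎
    where open ≡-Reasoning

  sum-≥0 : (xs : List A) {f : A → ℤ} → (∀ x → 0ℤ ≤ f x) → 0ℤ ≤ sum xs f
  sum-≥0 xs {f} f≥0 = subst (_≤ sum xs f) (sum-0 xs) (sum-mono xs f≥0)

  -- Induction on the list: a new head `a` enlarges the gap between the two sides by the sum of
  -- `(f y - a)²` over the tail, which is non-negative.
  cauchy-schwarz : (xs : List A) (f : A → ℤ) →
    sum xs f * sum xs f ≤ + length xs * (∑[ x ∈ xs ] (f x * f x))
  cauchy-schwarz []       f = ≤-refl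
  cauchy-schwarz (x ∷ xs) f = begin
    (a + s) * (a + s)                              ≡⟨ lemma₁ a s ⟩
    -- The trailing `0ℤ` holds the place of the sum of the squares `(f y - a)²`.
    s * s + (a * a + + 2 * a * s) + 0ℤ             ≤⟨ +-mono-≤ (+-monoˡ-≤ _ (cauchy-schwarz xs f))
                                                       (sum-≥0 xs (λ y → i*i≥0 (f y - a))) ⟩
    l * q + (a * a + + 2 * a * s) + (∑[ y ∈ xs ] ((f y - a) * (f y - a)))
                                                   ≡⟨ cong (λ z → l * q + (a * a + + 2 * a * s) + z) (sum-[f-c]² xs f a) ⟩
    l * q + (a * a + + 2 * a * s) + (q - + 2 * a * s + l * (a * a))
                                                   ≡⟨ lemma₂ a s l q ⟩
    (1ℤ + l) * (a * a + q)                         ∎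
    where
    open ≤-Reasoning
    a s l q : ℤ
    a = f x
    s = sum xs f
    l = + length xs
    q = ∑[ y ∈ xs ] (f y * f y)
    lemma₁ : ∀ a s → (a + s) * (a + s) ≡ s * s + (a * a + + 2 * a * s) + 0ℤ
    lemma₁ = solve-∀
    lemma₂ : ∀ a s l q → l * q + (a * a + + 2 * a * s) + (q - + 2 * a * s + l * (a * a)) ≡
      (1ℤ + l) * (a * a + q)
    lemma₂ = solve-∀

  -- One occurrence of the head `x` is cut out of `ys`; the rest still contains the tail, because
  -- `x` does not recur there. What remains of `ys` at the end has a non-negative sum.
  sum-⊆ : {xs ys : List A} {f : A → ℤ} → Unique xs → xs ⊆ ys → (∀ x → 0ℤ ≤ f x) →
    sum xs f ≤ sum ys f
  sum-⊆ {ys = ys} [] _ f≥0 = sum-≥0 ys f≥0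
  sum-⊆ {xs = x ∷ xs} {f = f} (x∉xs ∷ xs!) xs⊆ys f≥0
    with us , vs , refl ← ∈-∃++ (xs⊆ys (here refl)) = begin
    f x + sum xs f               ≤⟨ +-monoʳ-≤ (f x) (sum-⊆ xs! xs⊆us++vs f≥0) ⟩
    f x + sum (us ++ vs) f       ≡⟨ cong (_+_ (f x)) (sum-++ us vs f) ⟩
    f x + (sum us f + sum vs f)  ≡⟨ lemma (f x) (sum us f) (sum vs f) ⟩
    sum us f + (f x + sum vs f)  ≡⟨ sum-++ us (x ∷ vs) f ⟨
    sum (us ++ x ∷ vs) f         ∎
    where
    open ≤-Reasoning
    lemma : ∀ a b c → a + (b + c) ≡ b + (a + c)
    lemma = solve-∀
    xs⊆us++vs : xs ⊆ us ++ vs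
    xs⊆us++vs y∈xs with ∈-++⁻ us (xs⊆ys (there y∈xs))
    ... | inj₁ y∈us         = ∈-++⁺ˡ y∈us
    ... | inj₂ (here refl)  = contradiction refl (All.lookup x∉xs y∈xs)
    ... | inj₂ (there y∈vs) = ∈-++⁺ʳ us y∈vs

  length-⊆ : {xs ys : List A} → Unique xs → xs ⊆ ys → length xs ℕ.≤ length ys
  length-⊆ {xs = xs} {ys} xs! xs⊆ys = drop‿+≤+ (subst₂ _≤_ (sum-1 xs) (sum-1 ys)
    (sum-⊆ xs! xs⊆ys (λ _ → +≤+ ℕ.z≤n)))

  sum-∈ : {xs : List A} {x : A} {f : A → ℤ} → x ∈ xs → (∀ x → 0ℤ ≤ f x) → f x ≤ sum xs f
  sum-∈ {x = x} {f} x∈xs f≥0 = subst (_≤ _) (+-identityʳ (f x))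
    (sum-⊆ (All.[] ∷ []) (λ { (here refl) → x∈xs }) f≥0)

  𝟙[_] : Dec A → ℤ
  𝟙[ yes _ ] = 1ℤ
  𝟙[ no  _ ] = 0ℤ

  𝟙≥0 : (d : Dec A) → 0ℤ ≤ 𝟙[ d ]
  𝟙≥0 (yes _) = +≤+ ℕ.z≤n
  𝟙≥0 (no  _) = ≤-refl

  𝟙*𝟙≥0 : (d : Dec A) (d′ : Dec B) → 0ℤ ≤ 𝟙[ d ] * 𝟙[ d′ ]
  𝟙*𝟙≥0 (yes _) (yes _) = +≤+ ℕ.z≤n
  𝟙*𝟙≥0 (yes _) (no  _) = ≤-refl
  𝟙*𝟙≥0 (no  _) _       = ≤-refl

  𝟙-true : (d : Dec A) → A → 𝟙[ d ] ≡ 1ℤ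
  𝟙-true (yes _) _ = refl
  𝟙-true (no ¬a) a = contradiction a ¬a

  𝟙-cong : (d : Dec A) (d′ : Dec B) → (A → B) → (B → A) → 𝟙[ d ] ≡ 𝟙[ d′ ]
  𝟙-cong (yes _) (yes _) _ _ = refl
  𝟙-cong (yes a) (no ¬b) f _ = contradiction (f a) ¬b
  𝟙-cong (no ¬a) (yes b) _ g = contradiction (g b) ¬a
  𝟙-cong (no _)  (no _)  _ _ = refl

  length-filter≡sum : {P : Pred A _} (P? : Decidable P) (xs : List A) →
    + length (filter P? xs) ≡ ∑[ x ∈ xs ] 𝟙[ P? x ]
  length-filter≡sum P? []       = refl
  length-filter≡sum P? (x ∷ xs) with P? x
  ... | yes _ = cong (_+_ 1ℤ) (length-filter≡sum P? xs)
  ... | no  _ = trans (length-filter≡sum P? xs) (sym (+-identityˡ _))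

  -- Turns unique solvability of an equation into a count of its solutions: every entry other than
  -- `a` contributes 0, and `a` occurs once.
  sum-𝟙-unique : {P : Pred A _} (P? : Decidable P) {xs : List A} {a : A} → Unique xs → a ∈ xs →
    P a → (∀ x → P x → x ≡ a) → ∑[ x ∈ xs ] 𝟙[ P? x ] ≡ 1ℤ
  sum-𝟙-unique P? {xs} {a} xs! a∈xs Pa P⇒≡ = go xs! a∈xs
    where
    vanish : ∀ {ys} → All (a ≢_) ys → ∑[ x ∈ ys ] 𝟙[ P? x ] ≡ 0ℤ
    vanish All.[]         = refl
    vanish {y ∷ ys} (a≢y All.∷ a∉ys) with P? y
    ... | yes Py = contradiction (sym (P⇒≡ y Py)) a≢y
    ... | no  _  = trans (+-identityˡ _) (vanish a∉ys)
    go : ∀ {ys} → Unique ys → a ∈ ys → ∑[ x ∈ ys ] 𝟙[ P? x ] ≡ 1ℤ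
    go {y ∷ ys} (y∉ys ∷ _)   (here refl) = cong₂ _+_ (𝟙-true (P? y) Pa) (vanish y∉ys)
    go {y ∷ ys} (y∉ys ∷ ys!) (there a∈ys) with P? y
    ... | yes Py = contradiction (P⇒≡ y Py) (All.lookup y∉ys a∈ys)
    ... | no  _  = trans (+-identityˡ _) (go ys! a∈ys)

  -- The second moment of line sizes in an abstract incidence structure.

  module SecondMoment
    {Pt Ln : Set} (points : List Pt) (lines : List Ln) (ι : Pt → Ln → ℤ) (N M : ℕ)
    (ι≥0 : ∀ P ℓ → 0ℤ ≤ ι P ℓ)
    (|points| : + length points ≡ + N * + N)
    (|lines| : + length lines ≡ + N * + N + + N * + M + 1ℤ)
    (degree : ∀ P → sum lines (ι P) ≡ + N + + M)
    (line-size : ∀ ℓ → ∑[ P ∈ points ] ι P ℓ ≤ + N)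
    (joined : ∀ P P′ → 1ℤ ≤ ∑[ ℓ ∈ lines ] (ι P ℓ * ι P′ ℓ))
    (1≤NM : 1ℤ ≤ + N * + M)
    where

    -- Shifted by 1 so that `joined` makes it non-negative; sums over `E` may then be enlarged to
    -- sums over all points.
    excess : Pt → Pt → ℤ
    excess P P′ = (∑[ ℓ ∈ lines ] (ι P ℓ * ι P′ ℓ)) - 1ℤ

    -- The `N + M` lines through `P` carry at most `N` points each, so at most `(N + M) N`
    -- incidences; subtracting 1 for each of the `N²` points leaves `N M`.
    sum-excess : ∀ P → ∑[ P′ ∈ points ] excess P P′ ≤ + N * + M
    sum-excess P = begin
      ∑[ P′ ∈ points ] excess P P′
        ≡⟨ sum-minus points (λ P′ → ∑[ ℓ ∈ lines ] (ι P ℓ * ι P′ ℓ)) 1ℤ ⟩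
      (∑[ P′ ∈ points ] ∑[ ℓ ∈ lines ] (ι P ℓ * ι P′ ℓ)) - + length points * 1ℤ
        ≡⟨ cong₂ _-_ (sum-swap points lines (λ P′ ℓ → ι P ℓ * ι P′ ℓ))
             (trans (*-identityʳ _) |points|) ⟩
      (∑[ ℓ ∈ lines ] ∑[ P′ ∈ points ] (ι P ℓ * ι P′ ℓ)) - + N * + N
        ≡⟨ cong (_- + N * + N) (sum-cong lines (λ ℓ → sum-*ˡ points (ι P ℓ) (λ P′ → ι P′ ℓ))) ⟩
      (∑[ ℓ ∈ lines ] (ι P ℓ * (∑[ P′ ∈ points ] ι P′ ℓ))) - + N * + N
        ≤⟨ +-monoˡ-≤ (- (+ N * + N)) (sum-mono lines (λ ℓ →
             *-monoˡ-≤-nonNeg (ι P ℓ) {{nonNegative (ι≥0 P ℓ)}} (line-size ℓ))) ⟩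
      (∑[ ℓ ∈ lines ] (ι P ℓ * + N)) - + N * + N
        ≡⟨ cong (_- + N * + N) (trans (sum-*ʳ lines (+ N) (ι P)) (cong (_* + N) (degree P))) ⟩
      (+ N + + M) * + N - + N * + N
        ≡⟨ lemma (+ N) (+ M) ⟩
      + N * + M ∎
      where
      open ≤-Reasoning
      lemma : ∀ N M → (N + M) * N - N * N ≡ N * M
      lemma = solve-∀

    module _ {E : List Pt} (E! : Unique E) (E⊆points : E ⊆ points) where

      n : ℤ
      n = + length E

      e : Ln → ℤ
      e ℓ = ∑[ P ∈ E ] ι P ℓ

      sum-e : sum lines e ≡ n * (+ N + + M)
      sum-e = trans (sum-swap lines E (λ ℓ P → ι P ℓ))
        (trans (sum-cong E degree) (sum-const E (+ N + + M)))

      -- The square of `e ℓ` counts ordered pairs of points of `E` on `ℓ`. Writing the number of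
      -- common lines of each pair as 1 plus `excess` gives `n²` and, for each first point, an error
      -- of at most `N M`.
      sum-e² : ∑[ ℓ ∈ lines ] (e ℓ * e ℓ) ≤ n * n + n * (+ N * + M)
      sum-e² = begin
        ∑[ ℓ ∈ lines ] (e ℓ * e ℓ)
          ≡⟨ sum-cong lines (λ ℓ → sum-square E (λ P → ι P ℓ)) ⟩
        ∑[ ℓ ∈ lines ] ∑[ P ∈ E ] ∑[ P′ ∈ E ] (ι P ℓ * ι P′ ℓ)
          ≡⟨ sum-swap lines E (λ ℓ P → ∑[ P′ ∈ E ] (ι P ℓ * ι P′ ℓ)) ⟩
        ∑[ P ∈ E ] ∑[ ℓ ∈ lines ] ∑[ P′ ∈ E ] (ι P ℓ * ι P′ ℓ)
          ≡⟨ sum-cong E (λ P → sum-swap lines E (λ ℓ P′ → ι P ℓ * ι P′ ℓ)) ⟩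
        ∑[ P ∈ E ] ∑[ P′ ∈ E ] ∑[ ℓ ∈ lines ] (ι P ℓ * ι P′ ℓ)
          ≡⟨ sum-cong E unshift ⟩
        ∑[ P ∈ E ] (n + (∑[ P′ ∈ E ] excess P P′))
          ≤⟨ sum-mono E (λ P → +-monoʳ-≤ n (≤-trans
               (sum-⊆ E! E⊆points (λ P′ → i≤j⇒0≤j-i (joined P P′))) (sum-excess P))) ⟩
        ∑[ P ∈ E ] (n + + N * + M)
          ≡⟨ trans (sum-const E (n + + N * + M)) (*-distribˡ-+ n n (+ N * + M)) ⟩
        n * n + n * (+ N * + M) ∎
        where
        open ≤-Reasoning
        lemma : ∀ a n → a ≡ n + (a - n * 1ℤ)
        lemma = solve-∀
        unshift : ∀ P → ∑[ P′ ∈ E ] ∑[ ℓ ∈ lines ] (ι P ℓ * ι P′ ℓ) ≡ n + (∑[ P′ ∈ E ] excess P P′)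
        unshift P = trans (lemma _ n) (cong (_+_ n) (sym (sum-minus E _ 1ℤ)))

      -- The deviation of `e ℓ` from the expected value `n / N` is scaled by `N` to stay integral.
      -- In the expansion the cross term is known exactly from `sum-e`, so only the sum of squares
      -- has to be estimated.
      second-moment : ∑[ ℓ ∈ lines ] ((+ N * e ℓ - n) * (+ N * e ℓ - n)) ≤
        n * (+ N * + N * + N * + M)
      second-moment = begin
        ∑[ ℓ ∈ lines ] ((+ N * e ℓ - n) * (+ N * e ℓ - n))
          ≡⟨ sum-[f-c]² lines (λ ℓ → + N * e ℓ) n ⟩
        (∑[ ℓ ∈ lines ] ((+ N * e ℓ) * (+ N * e ℓ)))
          - + 2 * n * (∑[ ℓ ∈ lines ] (+ N * e ℓ)) + + length lines * (n * n)
          ≡⟨ cong₂ _+_ (cong₂ (λ a b → a - + 2 * n * b)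
               (trans (sum-cong lines (λ ℓ → square (+ N) (e ℓ))) (sum-*ˡ lines (+ N * + N) _))
               (trans (sum-*ˡ lines (+ N) e) (cong (+ N *_) sum-e)))
               (cong (_* (n * n)) |lines|) ⟩
        + N * + N * Λ - + 2 * n * (+ N * (n * (+ N + + M))) + (+ N * + N + + N * + M + 1ℤ) * (n * n)
          ≤⟨ +-monoˡ-≤ _ (+-monoˡ-≤ _ (*-monoˡ-≤-nonNeg (+ N * + N) {{nonNegative (i*i≥0 (+ N))}} sum-e²)) ⟩
        + N * + N * (n * n + n * (+ N * + M)) - + 2 * n * (+ N * (n * (+ N + + M)))
          + (+ N * + N + + N * + M + 1ℤ) * (n * n)
          ≡⟨ collect (+ N) (+ M) n ⟩
        -- The `1ℤ` is the last summand of `|lines|`; `1≤NM` makes the whole coefficient of `n²`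
        -- non-positive.
        n * (+ N * + N * + N * + M) + n * n * (1ℤ - + N * + M)
          ≤⟨ +-monoʳ-≤ (n * (+ N * + N * + N * + M)) (*-monoˡ-≤-nonNeg (n * n) {{nonNegative (i*i≥0 n)}} (i≤j⇒i-j≤0 1≤NM)) ⟩
        n * (+ N * + N * + N * + M) + n * n * 0ℤ
          ≡⟨ drop₀ (n * (+ N * + N * + N * + M)) (n * n) ⟩
        n * (+ N * + N * + N * + M) ∎
        where
        open ≤-Reasoning
        Λ : ℤ
        Λ = ∑[ ℓ ∈ lines ] (e ℓ * e ℓ)
        square : ∀ N e → (N * e) * (N * e) ≡ N * N * (e * e)
        square = solve-∀
        collect : ∀ N M n → N * N * (n * n + n * (N * M)) - + 2 * n * (N * (n * (N + M)))
          + (N * N + N * M + 1ℤ) * (n * n) ≡ n * (N * N * N * M) + n * n * (1ℤ - N * M)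
        collect = solve-∀
        drop₀ : ∀ a b → a + b * 0ℤ ≡ a
        drop₀ = solve-∀

      -- `Δ` is the sum of the scaled deviations over `L`. Cauchy-Schwarz costs a factor `length L`,
      -- and the squares, being non-negative, may be summed over all lines.
      incidence-bound : {L : List Ln} → Unique L → L ⊆ lines →
        let Δ = + N * (∑[ ℓ ∈ L ] e ℓ) - n * + length L in
        Δ * Δ ≤ + N * + N * + N * + M * (n * + length L)
      incidence-bound {L} L! L⊆lines = begin
        Δ * Δ
          ≡⟨ cong₂ _*_ Δ≡sum Δ≡sum ⟩
        sum L dev * sum L dev
          ≤⟨ cauchy-schwarz L dev ⟩
        + length L * (∑[ ℓ ∈ L ] (dev ℓ * dev ℓ))
          ≤⟨ *-monoˡ-≤-nonNeg (+ length L) (≤-trans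
               (sum-⊆ L! L⊆lines (λ ℓ → i*i≥0 (dev ℓ))) second-moment) ⟩
        + length L * (n * (+ N * + N * + N * + M))
          ≡⟨ rearrange (+ length L) n (+ N * + N * + N * + M) ⟩
        + N * + N * + N * + M * (n * + length L) ∎
        where
        open ≤-Reasoning
        dev : Ln → ℤ
        dev ℓ = + N * e ℓ - n
        Δ : ℤ
        Δ = + N * (∑[ ℓ ∈ L ] e ℓ) - n * + length L
        Δ≡sum : Δ ≡ sum L dev
        Δ≡sum = sym (trans (sum-minus L (λ ℓ → + N * e ℓ) n)
          (cong₂ _-_ (sum-*ˡ L (+ N) e) (*-comm (+ length L) n)))
        rearrange : ∀ l n c → l * (n * c) ≡ c * (n * l)
        rearrange = solve-∀

-- Units and non-units of a finite local ring.

module LocalRing (R : FiniteCommRing) (local : FiniteCommRing.IsLocal R) where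

  open import Data.Integer.Base using (ℤ; +_; 0ℤ; 1ℤ; _+_; _*_; _-_; _≤_; +≤+)
  open import Data.Integer.Properties hiding (_≟_)
  open import Data.Nat.Tactic.RingSolver renaming (solve-∀ to ℕ-solve-∀)
  open IntegerSums
  open FiniteCommRing R renaming (_+_ to _⊕_; -_ to ⊝_)

  commutativeRing : CommutativeRing _ _
  commutativeRing = record { isCommutativeRing = isCommutativeRing }

  private
    module C = CommutativeRing commutativeRing
    module P = RingProperties C.ring

  open ≡-Reasoning

  isUnit? : Decidable IsUnit
  isUnit? a = map′ (λ any → let u , _ , au≡𝟙 = find any in u , au≡𝟙)
    (λ (u , au≡𝟙) → lose (complete u) au≡𝟙) (any? (λ u → (a · u) ≟ 𝟙) elements)

  NonUnit-𝟘 : NonUnit 𝟘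
  NonUnit-𝟘 (u , 0u≡𝟙) = proj₁ local (trans (sym 0u≡𝟙) (C.zeroˡ u))

  NonUnit-· : ∀ r {a} → NonUnit a → NonUnit (r · a)
  NonUnit-· r {a} ¬a (u , rau≡𝟙) = ¬a (r · u , (begin
    a · (r · u)  ≡⟨ C.*-assoc a r u ⟨
    a · r · u    ≡⟨ cong (_· u) (C.*-comm a r) ⟩
    r · a · u    ≡⟨ rau≡𝟙 ⟩
    𝟙            ∎))

  NonUnit-⊝ : ∀ {a} → NonUnit a → NonUnit (⊝ a)
  NonUnit-⊝ {a} ¬a = subst NonUnit (P.-1*x≈-x a) (NonUnit-· (⊝ 𝟙) ¬a)

  nonunits : List Carrier
  nonunits = filter (¬? ∘ isUnit?) elements

  ∈-nonunits : ∀ {a} → NonUnit a → a ∈ nonunits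
  ∈-nonunits {a} = ∈-filter⁺ (¬? ∘ isUnit?) (complete a)

  -- If `y ⊕ n` equals `z ⊕ m` with `n`, `m` non-units, then `y ⊕ ⊝ z` equals `m ⊕ ⊝ n`, a non-unit
  -- by locality, so `y` and `z` are congruent.
  cosets! : ∀ {reps} → AllPairs (λ a b → ¬ a ∼ b) reps →
    Unique (cartesianProductWith _⊕_ reps nonunits)
  cosets! []                              = []
  cosets! {y ∷ reps} (y≁reps ∷ reps-incongruent) = Unique.++⁺
    (Unique.map⁺ (P.+-cancelˡ y _ _) (Unique.filter⁺ (¬? ∘ isUnit?) unique))
    (cosets! reps-incongruent) disjoint
    where
    disjoint : Disjoint (map (y ⊕_) nonunits) (cartesianProductWith _⊕_ reps nonunits)
    disjoint (v∈y⊕ , v∈rest)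
      with n , n∈ , refl ← ∈-map⁻ (y ⊕_) v∈y⊕
         | z , m , z∈reps , m∈ , yn≡zm ← ∈-cartesianProductWith⁻ _⊕_ reps nonunits v∈rest
      = All.lookup y≁reps z∈reps (subst NonUnit difference
          (proj₂ local m (⊝ n) (nonunit m∈) (NonUnit-⊝ (nonunit n∈))))
      where
      nonunit : ∀ {a} → a ∈ nonunits → NonUnit a
      nonunit a∈ = proj₂ (∈-filter⁻ (¬? ∘ isUnit?) {xs = elements} a∈)
      difference : m ⊕ ⊝ n ≡ y ⊕ ⊝ z
      difference = P.+-cancelˡ z _ _ (begin
        z ⊕ (m ⊕ ⊝ n)    ≡⟨ C.+-assoc z m (⊝ n) ⟨
        z ⊕ m ⊕ ⊝ n      ≡⟨ cong (_⊕ ⊝ n) yn≡zm ⟨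
        y ⊕ n ⊕ ⊝ n      ≡⟨ P.//-rightDividesʳ n y ⟩
        y                ≡⟨ P.//-rightDividesˡ z y ⟨
        y ⊕ ⊝ z ⊕ z      ≡⟨ C.+-comm (y ⊕ ⊝ z) z ⟩
        z ⊕ (y ⊕ ⊝ z)    ∎)

  -- The translates of the set of non-units by the `q` representatives are pairwise disjoint inside
  -- the ring.
  q*|nonunits|≤card : ∀ {q} → ResidueFieldCard q → q ℕ.* length nonunits ℕ.≤ card
  q*|nonunits|≤card (reps , refl , incongruent , _) =
    subst (ℕ._≤ card) (length-cartesianProductWith _⊕_ reps nonunits)
      (length-⊆ (cosets! incongruent) (λ {x} _ → complete x))

  -- Canonical equations of lines.

  data CanonicalLine : Set where
    graph vert : (s t : Carrier) → CanonicalLine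
    void       : CanonicalLine

  -- The coefficient 1 stands at `y` for `graph` and at `x` for `vert`. That `s` is a non-unit for
  -- `vert` is imposed by `canonicalLines`, not by the type.
  _⊙_ : Point → CanonicalLine → Set
  (x , y) ⊙ graph s t = s · x ⊕ y ⊕ t ≡ 𝟘
  (x , y) ⊙ vert  s t = s · y ⊕ x ⊕ t ≡ 𝟘
  _       ⊙ void      = ⊥

  _⊙?_ : ∀ P ℓ → Dec (P ⊙ ℓ)
  (x , y) ⊙? graph s t = (s · x ⊕ y ⊕ t) ≟ 𝟘
  (x , y) ⊙? vert  s t = (s · y ⊕ x ⊕ t) ≟ 𝟘
  _       ⊙? void      = no λ ()

  -- The empty set is a line (a, b non-units, c a unit), represented by void.
  canonicalLines : List CanonicalLine
  canonicalLines = cartesianProductWith graph elements elements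
    ++ cartesianProductWith vert nonunits elements ++ void ∷ []

  graph∈ : ∀ s t → graph s t ∈ canonicalLines
  graph∈ s t = ∈-++⁺ˡ (∈-cartesianProductWith⁺ graph (complete s) (complete t))

  vert∈ : ∀ {s} t → NonUnit s → vert s t ∈ canonicalLines
  vert∈ t ¬s = ∈-++⁺ʳ (cartesianProductWith graph elements elements)
    (∈-++⁺ˡ (∈-cartesianProductWith⁺ vert (∈-nonunits ¬s) (complete t)))

  void∈ : void ∈ canonicalLines
  void∈ = ∈-++⁺ʳ (cartesianProductWith graph elements elements)
    (∈-++⁺ʳ (cartesianProductWith vert nonunits elements) (here refl))

  -- The equation is multiplied by the inverse `u` of `b`; multiplying by `b` undoes this, so no
  -- solutions are gained.
  normalise : ∀ {a b c u} x y → b · u ≡ 𝟙 →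
    a · x ⊕ b · y ⊕ c ≡ 𝟘 ⇔ (u · a) · x ⊕ y ⊕ u · c ≡ 𝟘
  normalise {a} {b} {c} {u} x y bu≡𝟙 = mk⇔
    (λ v≡𝟘 → trans (sym scaled) (trans (cong (u ·_) v≡𝟘) (C.zeroʳ u)))
    (λ w≡𝟘 → begin
      v              ≡⟨ cancel v ⟨
      b · (u · v)    ≡⟨ cong (b ·_) (trans scaled w≡𝟘) ⟩
      b · 𝟘          ≡⟨ C.zeroʳ b ⟩
      𝟘              ∎)
    where
    v : Carrier
    v = a · x ⊕ b · y ⊕ c
    cancel : ∀ z → b · (u · z) ≡ z
    cancel z = trans (sym (C.*-assoc b u z)) (trans (cong (_· z) bu≡𝟙) (C.*-identityˡ z))
    scaled : u · v ≡ (u · a) · x ⊕ y ⊕ u · c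
    scaled = begin
      u · v
        ≡⟨ C.distribˡ u _ c ⟩
      u · (a · x ⊕ b · y) ⊕ u · c
        ≡⟨ cong (_⊕ u · c) (C.distribˡ u (a · x) (b · y)) ⟩
      u · (a · x) ⊕ u · (b · y) ⊕ u · c
        ≡⟨ cong (_⊕ u · c) (cong₂ _⊕_ (sym (C.*-assoc u a x)) uby≡y) ⟩
      (u · a) · x ⊕ y ⊕ u · c ∎
      where
      uby≡y : u · (b · y) ≡ y
      uby≡y = trans (sym (C.*-assoc u b y)) (trans (cong (_· y) (C.*-comm u b))
        (trans (C.*-assoc b u y) (cancel y)))

  -- A unit coefficient, sought first at `y` and then at `x`, is scaled to 1. In the second case `b`
  -- is a non-unit, and so is `u · b`.
  canonical : (ℓ : Line) →
    ∃ λ k → k ∈ canonicalLines × (∀ P → P on ℓ ⇔ P ⊙ k)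
  canonical (line a b c nondeg) with isUnit? b | isUnit? a
  ... | yes (u , bu≡𝟙) | _ =
    graph (u · a) (u · c) , graph∈ _ _ , λ (x , y) → normalise x y bu≡𝟙
  ... | no ¬b | yes (u , au≡𝟙) =
    vert (u · b) (u · c) , vert∈ _ (NonUnit-· u ¬b) ,
    -- `normalise` with the two coordinates exchanged.
    λ (x , y) → subst (λ v → v ⊕ c ≡ 𝟘 ⇔ (x , y) ⊙ vert (u · b) (u · c))
      (C.+-comm (b · y) (a · x)) (normalise y x au≡𝟙)
  -- A point on the line would make `c` minus a sum of two non-units, hence a non-unit, against
  -- `nondeg`.
  ... | no ¬b | no ¬a = void , void∈ , λ (x , y) → mk⇔
    (λ v≡𝟘 → nondeg (¬a , ¬b , subst NonUnit (sym (P.+-inverseʳ-unique _ c v≡𝟘))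
      (NonUnit-⊝ (proj₂ local _ _
        (subst NonUnit (C.*-comm x a) (NonUnit-· x ¬a))
        (subst NonUnit (C.*-comm y b) (NonUnit-· y ¬b))))))
    λ ()

  canon : Line → CanonicalLine
  canon ℓ = proj₁ (canonical ℓ)

  canon-⊆ : (L : List Line) → map canon L ⊆ canonicalLines
  canon-⊆ L k∈ with ℓ , _ , refl ← ∈-map⁻ canon k∈ = proj₁ (proj₂ (canonical ℓ))

  on⇔⊙canon : ∀ P ℓ → P on ℓ ⇔ P ⊙ canon ℓ
  on⇔⊙canon P ℓ = proj₂ (proj₂ (canonical ℓ)) P

  -- A canonical form determines the point set, so lines with different point sets have different
  -- forms.
  canon! : {L : List Line} → IsLineSet L → Unique (map canon L)
  canon! = AllPairs.map⁺ ∘ AllPairs.map λ {ℓ} {ℓ′} ¬same eq → ¬same λ P →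
    (λ on → from (on⇔⊙canon P ℓ′) (subst (P ⊙_) eq (to (on⇔⊙canon P ℓ) on))) ,
    (λ on → from (on⇔⊙canon P ℓ) (subst (P ⊙_) (sym eq) (to (on⇔⊙canon P ℓ′) on)))
    where open Equivalence

  -- Counting points, canonical lines and their incidences.

  ι : Point → CanonicalLine → ℤ
  ι P ℓ = 𝟙[ P ⊙? ℓ ]

  sum-canonicalLines : (f : CanonicalLine → ℤ) → sum canonicalLines f ≡
    (∑[ s ∈ elements ] ∑[ t ∈ elements ] f (graph s t)) +
    (∑[ s ∈ nonunits ] ∑[ t ∈ elements ] f (vert s t)) + f void
  sum-canonicalLines f = begin
    sum canonicalLines f
      ≡⟨ sum-++ (cartesianProductWith graph elements elements) _ f ⟩
    sum (cartesianProductWith graph elements elements) f +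
      sum (cartesianProductWith vert nonunits elements ++ void ∷ []) f
      ≡⟨ cong₂ _+_ (sum-cartesianProductWith graph elements elements f)
           (trans (sum-++ (cartesianProductWith vert nonunits elements) _ f)
             (cong₂ _+_ (sum-cartesianProductWith vert nonunits elements f) (+-identityʳ (f void)))) ⟩
    g + (v + f void)
      ≡⟨ +-assoc g v (f void) ⟨
    g + v + f void ∎
    where
    g v : ℤ
    g = ∑[ s ∈ elements ] ∑[ t ∈ elements ] f (graph s t)
    v = ∑[ s ∈ nonunits ] ∑[ t ∈ elements ] f (vert s t)

  solutions-t : ∀ s x y → ∑[ t ∈ elements ] 𝟙[ (s · x ⊕ y ⊕ t) ≟ 𝟘 ] ≡ 1ℤ
  solutions-t s x y = sum-𝟙-unique (λ t → (s · x ⊕ y ⊕ t) ≟ 𝟘) unique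
    (complete (⊝ (s · x ⊕ y))) (C.-‿inverseʳ _) (λ t → P.+-inverseʳ-unique _ t)

  solutions-y : ∀ s x t → ∑[ y ∈ elements ] 𝟙[ (s · x ⊕ y ⊕ t) ≟ 𝟘 ] ≡ 1ℤ
  solutions-y s x t = sum-𝟙-unique (λ y → (s · x ⊕ y ⊕ t) ≟ 𝟘) unique
    (complete (⊝ (s · x ⊕ t))) (trans (exchange _) (C.-‿inverseʳ _))
    (λ y eq → P.+-inverseʳ-unique _ y (trans (sym (exchange y)) eq))
    where
    exchange : ∀ y → s · x ⊕ y ⊕ t ≡ s · x ⊕ t ⊕ y
    exchange y = trans (C.+-assoc (s · x) y t)
      (trans (cong (s · x ⊕_) (C.+-comm y t)) (sym (C.+-assoc (s · x) t y)))

  -- Through a given point each admissible `s` admits exactly one `t`: `card` choices of `s` for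
  -- `graph`, the non-units for `vert`.
  degree : ∀ P → sum canonicalLines (ι P) ≡ + card + + length nonunits
  degree (x , y) = begin
    sum canonicalLines (ι (x , y))
      ≡⟨ sum-canonicalLines (ι (x , y)) ⟩
    (∑[ s ∈ elements ] ∑[ t ∈ elements ] 𝟙[ (s · x ⊕ y ⊕ t) ≟ 𝟘 ]) +
    (∑[ s ∈ nonunits ] ∑[ t ∈ elements ] 𝟙[ (s · y ⊕ x ⊕ t) ≟ 𝟘 ]) + 0ℤ
      ≡⟨ +-identityʳ _ ⟩
    (∑[ s ∈ elements ] ∑[ t ∈ elements ] 𝟙[ (s · x ⊕ y ⊕ t) ≟ 𝟘 ]) +
    (∑[ s ∈ nonunits ] ∑[ t ∈ elements ] 𝟙[ (s · y ⊕ x ⊕ t) ≟ 𝟘 ])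
      ≡⟨ cong₂ _+_
           (trans (sum-cong elements (λ s → solutions-t s x y)) (sum-1 elements))
           (trans (sum-cong nonunits (λ s → solutions-t s y x)) (sum-1 nonunits)) ⟩
    + card + + length nonunits ∎

  points : List Point
  points = cartesianProduct elements elements

  |points| : + length points ≡ + card * + card
  |points| = trans (cong +_ (length-cartesianProductWith _,_ elements elements)) (pos-* card card)

  |canonicalLines| : + length canonicalLines ≡
    + card * + card + + card * + length nonunits + 1ℤ
  |canonicalLines| = begin
    + length canonicalLines
      ≡⟨ sum-1 canonicalLines ⟨
    sum canonicalLines (λ _ → 1ℤ)
      ≡⟨ sum-canonicalLines (λ _ → 1ℤ) ⟩
    (∑[ s ∈ elements ] ∑[ t ∈ elements ] 1ℤ) + (∑[ s ∈ nonunits ] ∑[ t ∈ elements ] 1ℤ) + 1ℤ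
      ≡⟨ cong (_+ 1ℤ) (cong₂ _+_ (count elements) (trans (count nonunits) (*-comm (+ length nonunits) (+ card)))) ⟩
    + card * + card + + card * + length nonunits + 1ℤ ∎
    where
    count : ∀ xs → ∑[ s ∈ xs ] ∑[ t ∈ elements ] 1ℤ ≡ + length xs * + card
    count xs = trans (sum-cong xs (λ _ → sum-1 elements)) (sum-const xs (+ card))

  -- One coordinate is free and determines the other, `y` for `graph` and `x` for `vert`, so
  -- equality holds except for `void`.
  line-size : ∀ ℓ → ∑[ P ∈ points ] ι P ℓ ≤ + card
  line-size (graph s t) = ≤-reflexive (begin
    sum points (λ P → ι P (graph s t))
      ≡⟨ sum-cartesianProductWith _,_ elements elements (λ P → ι P (graph s t)) ⟩
    ∑[ x ∈ elements ] ∑[ y ∈ elements ] 𝟙[ (s · x ⊕ y ⊕ t) ≟ 𝟘 ]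
      ≡⟨ sum-cong elements (λ x → solutions-y s x t) ⟩
    ∑[ x ∈ elements ] 1ℤ
      ≡⟨ sum-1 elements ⟩
    + card ∎)
  line-size (vert s t) = ≤-reflexive (begin
    sum points (λ P → ι P (vert s t))
      ≡⟨ sum-cartesianProductWith _,_ elements elements (λ P → ι P (vert s t)) ⟩
    ∑[ x ∈ elements ] ∑[ y ∈ elements ] 𝟙[ (s · y ⊕ x ⊕ t) ≟ 𝟘 ]
      ≡⟨ sum-swap elements elements (λ x y → 𝟙[ (s · y ⊕ x ⊕ t) ≟ 𝟘 ]) ⟩
    ∑[ y ∈ elements ] ∑[ x ∈ elements ] 𝟙[ (s · y ⊕ x ⊕ t) ≟ 𝟘 ]
      ≡⟨ sum-cong elements (λ y → solutions-y s y t) ⟩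
    ∑[ y ∈ elements ] 1ℤ
      ≡⟨ sum-1 elements ⟩
    + card ∎)
  line-size void = subst (_≤ + card) (sym (sum-0 points)) (+≤+ ℕ.z≤n)

  1≤card*|nonunits| : 1ℤ ≤ + card * + length nonunits
  1≤card*|nonunits| = subst (1ℤ ≤_) (pos-* card (length nonunits))
    (+≤+ (ℕ.*-mono-≤ (inhabited (complete 𝟘)) (inhabited (∈-nonunits NonUnit-𝟘))))
    where
    inhabited : ∀ {x : Carrier} {xs} → x ∈ xs → 1 ℕ.≤ length xs
    inhabited {xs = _ ∷ _} _ = ℕ.s≤s ℕ.z≤n

  1<card : 1 ℕ.< card
  1<card = length-⊆ ((proj₁ local All.∷ All.[]) ∷ All.[] ∷ []) (λ {x} _ → complete x)

  -- Cancelling `q` in `q*|nonunits|≤card` leaves at most `q^(r-1)` non-units, and `3r + (r - 1)` is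
  -- `4r - 1`.
  card³*|nonunits|≤ : ∀ q r → .{{ℕ.NonZero q}} → ResidueFieldCard q → card ≡ q ℕ.^ r →
    card ℕ.^ 3 ℕ.* length nonunits ℕ.≤ q ℕ.^ (4 ℕ.* r ℕ.∸ 1)
  -- A ring with `𝟙` different from `𝟘` has at least two elements; for positive exponents `∸` is
  -- ordinary subtraction.
  card³*|nonunits|≤ q ℕ.zero  residue card≡1 = contradiction card≡1 (ℕ.>⇒≢ 1<card)
  card³*|nonunits|≤ q (suc r) residue card≡  = ℕ.≤-trans (ℕ.*-monoʳ-≤ (card ℕ.^ 3) |nonunits|≤q^r)
    (ℕ.≤-reflexive (begin
      card ℕ.^ 3 ℕ.* q ℕ.^ r             ≡⟨ cong (λ N → N ℕ.^ 3 ℕ.* q ℕ.^ r) card≡ ⟩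
      (q ℕ.^ suc r) ℕ.^ 3 ℕ.* q ℕ.^ r    ≡⟨ cong (ℕ._* q ℕ.^ r) (ℕ.^-*-assoc q (suc r) 3) ⟩
      q ℕ.^ (suc r ℕ.* 3) ℕ.* q ℕ.^ r    ≡⟨ ℕ.^-distribˡ-+-* q (suc r ℕ.* 3) r ⟨
      q ℕ.^ (suc r ℕ.* 3 ℕ.+ r)          ≡⟨ cong (λ k → q ℕ.^ (k ℕ.∸ 1)) (exponent r) ⟩
      q ℕ.^ (4 ℕ.* suc r ℕ.∸ 1)          ∎))
    where
    |nonunits|≤q^r : length nonunits ℕ.≤ q ℕ.^ r
    |nonunits|≤q^r = ℕ.*-cancelˡ-≤ q (subst (q ℕ.* length nonunits ℕ.≤_) card≡ (q*|nonunits|≤card residue))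
    exponent : ∀ r → 1 ℕ.+ (suc r ℕ.* 3 ℕ.+ r) ≡ 4 ℕ.* suc r
    exponent = ℕ-solve-∀

  -- Joining two points over a chain ring.

  module ChainRing (chain : IsChain) where

    principal : Carrier → Ideal
    principal a = record
      { mem      = λ x → ∃ λ w → x ≡ w · a
      ; has-𝟘    = 𝟘 , sym (C.zeroˡ a)
      ; +-closed = λ { (v , refl) (w , refl) → v ⊕ w , sym (C.distribʳ a v w) }
      ; ·-closed = λ { r (w , refl) → r · w , sym (C.*-assoc r w a) }
      }

    -- Of two comparable principal ideals, the smaller has its generator in the larger.
    divides-total : ∀ a b → (∃ λ w → b ≡ w · a) ⊎ (∃ λ w → a ≡ w · b)
    divides-total a b with chain (principal a) (principal b)
    ... | inj₁ a⊆b = inj₂ (a⊆b a (𝟙 , sym (C.*-identityˡ a)))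
    ... | inj₂ b⊆a = inj₁ (b⊆a b (𝟙 , sym (C.*-identityˡ b)))

    -- With coefficient `⊝ w`, both points require the same constant term, so one equation serves
    -- both.
    slope : ∀ {x x′ y y′ w} → y ⊕ ⊝ y′ ≡ w · (x ⊕ ⊝ x′) → ⊝ w · x ⊕ y ≡ ⊝ w · x′ ⊕ y′
    slope {x} {x′} {y} {y′} {w} eq = begin
      ⊝ w · x ⊕ y
        ≡⟨ cong₂ _⊕_ (sym (P.-‿distribˡ-* w x)) (sym (P.//-rightDividesˡ y′ y)) ⟩
      ⊝ (w · x) ⊕ (y ⊕ ⊝ y′ ⊕ y′)
        ≡⟨ cong (λ z → ⊝ (w · x) ⊕ (z ⊕ y′)) (trans eq (P.x[y-z]≈xy-xz w x x′)) ⟩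
      ⊝ (w · x) ⊕ (w · x ⊕ ⊝ (w · x′) ⊕ y′)
        ≡⟨ cong (⊝ (w · x) ⊕_) (C.+-assoc (w · x) (⊝ (w · x′)) y′) ⟩
      ⊝ (w · x) ⊕ (w · x ⊕ (⊝ (w · x′) ⊕ y′))
        ≡⟨ P.\\-leftDividesʳ (w · x) _ ⟩
      ⊝ (w · x′) ⊕ y′
        ≡⟨ cong (_⊕ y′) (P.-‿distribˡ-* w x′) ⟩
      ⊝ w · x′ ⊕ y′ ∎

    intercept : ∀ {v v′} → v ≡ v′ → (v ⊕ ⊝ v ≡ 𝟘) × (v′ ⊕ ⊝ v ≡ 𝟘)
    intercept {v} refl = C.-‿inverseʳ v , C.-‿inverseʳ v

    -- One coordinate difference divides the other, and the quotient `w` gives the coefficient.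
    -- Coinciding points are covered, both differences being zero.
    join : ∀ P P′ → ∃ λ ℓ → ℓ ∈ canonicalLines × P ⊙ ℓ × P′ ⊙ ℓ
    join (x , y) (x′ , y′) with divides-total (x ⊕ ⊝ x′) (y ⊕ ⊝ y′)
    -- The constant term left open is fixed by `intercept` as `⊝ (⊝ w · x ⊕ y)`.
    ... | inj₁ (w , eq) = graph (⊝ w) _ , graph∈ _ _ , intercept (slope eq)
    ... | inj₂ (w , eq) with isUnit? w
    ...   | no ¬w = vert (⊝ w) _ , vert∈ _ (NonUnit-⊝ ¬w) , intercept (slope eq)
    -- `vert` is listed for non-unit coefficients only, so a unit quotient is inverted to give a
    -- `graph`.
    ...   | yes (u , wu≡𝟙) = graph (⊝ u) _ , graph∈ _ _ , intercept (slope (begin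
      y ⊕ ⊝ y′              ≡⟨ C.*-identityˡ _ ⟨
      𝟙 · (y ⊕ ⊝ y′)        ≡⟨ cong (_· (y ⊕ ⊝ y′)) (trans (C.*-comm u w) wu≡𝟙) ⟨
      u · w · (y ⊕ ⊝ y′)    ≡⟨ C.*-assoc u w _ ⟩
      u · (w · (y ⊕ ⊝ y′))  ≡⟨ cong (u ·_) eq ⟨
      u · (x ⊕ ⊝ x′)        ∎))

    ι≥0 : ∀ P ℓ → 0ℤ ≤ ι P ℓ
    ι≥0 P ℓ = 𝟙≥0 (P ⊙? ℓ)

    joined : ∀ P P′ → 1ℤ ≤ ∑[ ℓ ∈ canonicalLines ] (ι P ℓ * ι P′ ℓ)
    joined P P′ with ℓ , ℓ∈ , P⊙ℓ , P′⊙ℓ ← join P P′ =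
      subst (_≤ _) (cong₂ _*_ (𝟙-true (P ⊙? ℓ) P⊙ℓ) (𝟙-true (P′ ⊙? ℓ) P′⊙ℓ))
        (sum-∈ ℓ∈ (λ k → 𝟙*𝟙≥0 (P ⊙? k) (P′ ⊙? k)))

    private
      module Moment = SecondMoment points canonicalLines ι card (length nonunits) ι≥0
        |points| |canonicalLines| degree line-size joined 1≤card*|nonunits|

    -- Transfer of the bound to the given points and lines.

    incidences≡ : ∀ E L →
      + incidences E L ≡ ∑[ k ∈ map canon L ] ∑[ P ∈ E ] ι P k
    incidences≡ E L = begin
      + incidences E L
        ≡⟨ length-filter≡sum (λ Pℓ → proj₁ Pℓ on? proj₂ Pℓ) (cartesianProduct E L) ⟩
      ∑[ Pℓ ∈ cartesianProduct E L ] 𝟙[ proj₁ Pℓ on? proj₂ Pℓ ]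
        ≡⟨ sum-cartesianProductWith _,_ E L _ ⟩
      ∑[ P ∈ E ] ∑[ ℓ ∈ L ] 𝟙[ P on? ℓ ]
        ≡⟨ sum-swap E L (λ P ℓ → 𝟙[ P on? ℓ ]) ⟩
      ∑[ ℓ ∈ L ] ∑[ P ∈ E ] 𝟙[ P on? ℓ ]
        ≡⟨ sum-cong L (λ ℓ → sum-cong E (λ P → let open Equivalence (on⇔⊙canon P ℓ) in
             𝟙-cong (P on? ℓ) (P ⊙? canon ℓ) to from)) ⟩
      ∑[ ℓ ∈ L ] ∑[ P ∈ E ] ι P (canon ℓ)
        ≡⟨ sum-map canon L (λ k → ∑[ P ∈ E ] ι P k) ⟨
      ∑[ k ∈ map canon L ] ∑[ P ∈ E ] ι P k ∎

    -- The second-moment bound read in the natural numbers; the absolute difference appears squared,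
    -- so it agrees with the square of the signed `Δ`.
    incidences-bound : ∀ {E} → Unique E → ∀ {L} → IsLineSet L →
      ℕ.∣ card ℕ.* incidences E L - length E ℕ.* length L ∣ ℕ.^ 2
        ℕ.≤ card ℕ.^ 3 ℕ.* length nonunits ℕ.* (length E ℕ.* length L)
    incidences-bound {E} E! {L} L! = drop‿+≤+ (subst₂ _≤_ (sym lhs) (sym rhs)
      (Moment.incidence-bound E! (λ { {x , y} _ → ∈-cartesianProduct⁺ (complete x) (complete y) })
        (canon! L!) (canon-⊆ L)))
      where
      N I n l M : ℕ
      N = card
      I = incidences E L
      n = length E
      l = length L
      M = length nonunits
      Δ : ℤ
      Δ = + N * (∑[ k ∈ map canon L ] ∑[ P ∈ E ] ι P k) - + n * + length (map canon L)
      lhs : + (ℕ.∣ N ℕ.* I - n ℕ.* l ∣ ℕ.^ 2) ≡ Δ * Δ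
      lhs = trans (sym ([m-n]²≡∣m-n∣² (N ℕ.* I) (n ℕ.* l))) (cong (λ z → z * z)
        (cong₂ _-_ (trans (pos-* N I) (cong (+ N *_) (incidences≡ E L)))
          (trans (pos-* n l) (cong (λ k → + n * + k) (sym (length-map canon L))))))
      rhs : + (N ℕ.^ 3 ℕ.* M ℕ.* (n ℕ.* l)) ≡
        + N * + N * + N * + M * (+ n * + length (map canon L))
      rhs = begin
        + (N ℕ.^ 3 ℕ.* M ℕ.* (n ℕ.* l))
          ≡⟨ trans (pos-* (N ℕ.^ 3 ℕ.* M) (n ℕ.* l)) (cong (_* + (n ℕ.* l)) (pos-* (N ℕ.^ 3) M)) ⟩
        + (N ℕ.^ 3) * + M * + (n ℕ.* l)
          ≡⟨ cong₂ (λ a b → a * + M * b) cube (trans (pos-* n l) (cong (λ k → + n * + k) (sym (length-map canon L)))) ⟩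
        + N * + N * + N * + M * (+ n * + length (map canon L)) ∎
        where
        cube : + (N ℕ.^ 3) ≡ + N * + N * + N
        cube = begin
          + (N ℕ.^ 3)            ≡⟨ cong (λ z → + (N ℕ.* (N ℕ.* z))) (ℕ.*-identityʳ N) ⟩
          + (N ℕ.* (N ℕ.* N))    ≡⟨ pos-* N (N ℕ.* N) ⟩
          + N * + (N ℕ.* N)      ≡⟨ cong (+ N *_) (pos-* N N) ⟩
          + N * (+ N * + N)      ≡⟨ *-assoc (+ N) (+ N) (+ N) ⟨
          + N * + N * + N        ∎

-- Allows `q` to be cancelled when the non-units are counted.
oddPrimePower⇒nonZero : ∀ {q} → OddPrimePower q → ℕ.NonZero q
oddPrimePower⇒nonZero (p , k , p-prime , _ , _ , refl) = ℕ.m^n≢0 p k {{prime⇒nonZero p-prime}}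

open import Data.Nat using (ℕ; _*_; _^_; _≤_; _∸_; ∣_-_∣)

-- Multiplying the inequality by `q^r` and squaring removes the fraction and the root; the constant
-- becomes `q^(2r)` times `q^(2r-1)`.
theorem4p2 : (R : FiniteCommRing) (q r : ℕ) →
    FiniteCommRing.IsLocal R → FiniteCommRing.IsChain R →
    OddPrimePower q → FiniteCommRing.ResidueFieldCard R q →
    FiniteCommRing.card R ≡ q ^ r →
    (E : List (FiniteCommRing.Point R)) → Unique E →
    (L : List (FiniteCommRing.Line R)) → FiniteCommRing.IsLineSet R L →
    ∣ q ^ r * FiniteCommRing.incidences R E L - length E * length L ∣ ^ 2
    ≤ q ^ (4 * r ∸ 1) * (length E * length L)
theorem4p2 R q r local chain q-opp residue card≡ E E! L L! = begin
  ∣ q ^ r * incidences E L - length E * length L ∣ ^ 2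
    ≡⟨ cong (λ N → ∣ N * incidences E L - length E * length L ∣ ^ 2) card≡ ⟨
  ∣ card * incidences E L - length E * length L ∣ ^ 2
    ≤⟨ incidences-bound E! L! ⟩
  card ^ 3 * length nonunits * (length E * length L)
    ≤⟨ ℕ.*-monoˡ-≤ (length E * length L)
         (card³*|nonunits|≤ q r {{oddPrimePower⇒nonZero q-opp}} residue card≡) ⟩
  q ^ (4 * r ∸ 1) * (length E * length L) ∎
  where
  open FiniteCommRing R using (card; incidences)
  open LocalRing R local
  open ChainRing chain
  open ℕ.≤-Reasoning
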